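{- Let $\mathsf{C}$ be a small category with finite products. Let $U\colon\mathsf{Doct}^{\mathsf{C}}_{\forall\exists\mathsf{BA}}\to\mathsf{Doct}^{\mathsf{C}}_{\mathsf{BA}}$ be the forgetful functor, $F$ its left adjoint (which exists), and $\eta$ the unit of $F\dashv U$ (which is componentwise injective). Then any Boolean doctrine $\mathbf{P}$ over $\mathsf{C}$ has a quantifier completion, namely $(\mathrm{id}_{\mathsf{C}},\eta_{\mathbf{P}})\colon\mathbf{P}\to UF(\mathbf{P})$.
   Context: $\mathsf{BA}$ is the category of Boolean algebras and Boolean homomorphisms. A Boolean doctrine over a category $\mathsf{C}$ with finite products is a functor $\mathbf{P}\colon\mathsf{C}^{\mathrm{op}}\to\mathsf{BA}$. A Boolean doctrine morphism from $\mathbf{P}\colon\mathsf{C}^{\mathrm{op}}\to\mathsf{BA}$ to $\mathbf{R}\colon\mathsf{D}^{\mathrm{op}}\to\mathsf{BA}$ is a pair $(M,\mathfrak{m})$ with $M\colon\mathsf{C}\to\mathsf{D}$ a finite-product-preserving functor and $\mathfrak{m}\colon\mathbf{P}\to\mathbf{R}\circ M^{\mathrm{op}}$ a natural transformation; $(N,\mathfrak{n})\circ(M,\mathfrak{m})$ is $N\circ M$ together with the components $\mathfrak{n}_{M(X)}\circ\mathfrak{m}_X$. A Boolean doctrine $\mathbf{P}$ is a first-order Boolean doctrine if (i) for all $X,Y\in\mathsf{C}$ the map $\mathbf{P}(\mathrm{pr}_1)\colon\mathbf{P}(X)\to\mathbf{P}(X\times Y)$ has a right adjoint $(\forall Y)_X$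 (as an order-preserving map); and (ii) for every $f\colon X'\to X$ and every $Y$, $\mathbf{P}(f)\circ(\forall Y)_X=(\forall Y)_{X'}\circ\mathbf{P}(f\times\mathrm{id}_Y)$. A first-order Boolean doctrine morphism is a Boolean doctrine morphism $(M,\mathfrak{m})$ between first-order Boolean doctrines with $\mathfrak{m}_X\circ(\forall Y)_X=(\forall M(Y))_{M(X)}\circ\mathfrak{m}_{X\times Y}$ for all $X,Y$. $\mathsf{Doct}^{\mathsf{C}}_{\mathsf{BA}}$ is the category of Boolean doctrines over $\mathsf{C}$ and natural transformations. $\mathsf{Doct}^{\mathsf{C}}_{\forall\exists\mathsf{BA}}$ is the category of first-order Boolean doctrines over $\mathsf{C}$ and natural transformations $\mathfrak{m}$ with $\mathfrak{m}_X\circ(\forall Y)_X=(\forall Y)_X\circ\mathfrak{m}_{X\times Y}$ for all $X,Y\in\mathsf{C}$. A quantifier completion of a Boolean doctrine $\mathbf{P}$ is a Boolean doctrine morphism $(I,\mathfrak{i})\colon\mathbf{P}\to\mathbf{P}^{\forall\exists}$ with $\mathbf{P}^{\forall\exists}$ a first-order Boolean doctrine, such that for every first-order Boolean doctrine $\mathbf{R}\colon\mathsf{D}^{\mathrm{op}}\to\mathsf{BA}$ (over any, possibly large, base category with finite products) and every Boolean doctrine morphism $(M,\mathfrak{m})\colon\mathbf{P}\to\mathbf{R}$ there is a unique first-order Boolean doctrine morphism $(N,\mathfrak{n})\colon\mathbf{P}^{\forall\exists}\to\mathbf{R}$ with $(M,\mathfrak{m})=(N,\mathfrak{n})\circ(I,\mathfrak{i})$.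 -}

module Defs where

open import Level using (Level; _⊔_; suc)
open import Function.Base using (_∘_; id)
open import Function.Definitions using (Injective)
open import Data.Product.Base using (Σ; _,_) renaming (_×_ to _and_)
open import Relation.Binary.Core using (Rel; _Preserves_⟶_)
open import Relation.Binary.Bundles using (Poset)
open import Relation.Binary.Definitions using (Adjoint)
open import Relation.Binary.Structures using (IsEquivalence)
open import Relation.Binary.PropositionalEquality using (_≡_; subst; subst₂)
open import Algebra.Lattice.Bundles using (BooleanAlgebra)
open import Algebra.Lattice.Morphism.Structures using (IsLatticeHomomorphism)
import Algebra.Lattice.Morphism.Construct.Composition as Composition
import Algebra.Lattice.Morphism.Construct.Identity as Identity
import Algebra.Lattice.Properties.Lattice as LatticeProperties

private
  variable
    o h e o₁ h₁ e₁ o₂ h₂ e₂ o₃ h₃ e₃ ℓ : Level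

-- Parallel morphisms are compared by a setoid equality; objects, when they have
-- to be compared, by propositional equality.
record Category (o h e : Level) : Set (suc (o ⊔ h ⊔ e)) where
  infix  4 _≈_ _⇒_
  infixr 9 _⊚_
  field
    Obj           : Set o
    _⇒_           : Obj → Obj → Set h
    _≈_           : ∀ {A B} → Rel (A ⇒ B) e
    idm           : ∀ {A} → A ⇒ A
    _⊚_           : ∀ {A B C} → B ⇒ C → A ⇒ B → A ⇒ C
    isEquivalence : ∀ {A B} → IsEquivalence (_≈_ {A} {B})
    ⊚-cong        : ∀ {A B C} {f f′ : B ⇒ C} {g g′ : A ⇒ B} →
                    f ≈ f′ → g ≈ g′ → f ⊚ g ≈ f′ ⊚ g′
    assoc         : ∀ {A B C D} {f : A ⇒ B} {g : B ⇒ C} {k : C ⇒ D} →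
                    (k ⊚ g) ⊚ f ≈ k ⊚ (g ⊚ f)
    identityˡ     : ∀ {A B} {f : A ⇒ B} → idm ⊚ f ≈ f
    identityʳ     : ∀ {A B} {f : A ⇒ B} → f ⊚ idm ≈ f

  module ≈ {A B} = IsEquivalence (isEquivalence {A} {B})

_ᵒᵖ : Category o h e → Category o h e
C ᵒᵖ = record
  { Obj           = C.Obj
  ; _⇒_           = λ A B → B C.⇒ A
  ; _≈_           = C._≈_
  ; idm           = C.idm
  ; _⊚_           = λ f g → g C.⊚ f
  ; isEquivalence = C.isEquivalence
  ; ⊚-cong        = λ p q → C.⊚-cong q p
  ; assoc         = C.≈.sym C.assoc
  ; identityˡ     = C.identityʳ
  ; identityʳ     = C.identityˡ
  }
  where module C = Category C

record Functor (C : Category o h e) (D : Category o₁ h₁ e₁)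
               : Set (o ⊔ h ⊔ e ⊔ o₁ ⊔ h₁ ⊔ e₁) where
  private
    module C = Category C
    module D = Category D
  field
    F₀       : C.Obj → D.Obj
    F₁       : ∀ {A B} → A C.⇒ B → F₀ A D.⇒ F₀ B
    F₁-cong  : ∀ {A B} {f g : A C.⇒ B} → f C.≈ g → F₁ f D.≈ F₁ g
    identity : ∀ {A} → F₁ (C.idm {A}) D.≈ D.idm
    homo     : ∀ {A B E} {f : A C.⇒ B} {g : B C.⇒ E} →
               F₁ (g C.⊚ f) D.≈ F₁ g D.⊚ F₁ f

idF : (C : Category o h e) → Functor C C
idF C = record
  { F₀ = id ; F₁ = id ; F₁-cong = id ; identity = ≈.refl ; homo = ≈.refl }
  where open Category C

infixr 9 _∘F_
_∘F_ : {C : Category o h e} {D : Category o₁ h₁ e₁} {E : Category o₂ h₂ e₂} →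
       Functor D E → Functor C D → Functor C E
_∘F_ {E = E} G F = record
  { F₀       = G.F₀ ∘ F.F₀
  ; F₁       = G.F₁ ∘ F.F₁
  ; F₁-cong  = G.F₁-cong ∘ F.F₁-cong
  ; identity = ≈.trans (G.F₁-cong F.identity) G.identity
  ; homo     = ≈.trans (G.F₁-cong F.homo) G.homo
  }
  where
  module F = Functor F
  module G = Functor G
  open Category E

opF : {C : Category o h e} {D : Category o₁ h₁ e₁} →
      Functor C D → Functor (C ᵒᵖ) (D ᵒᵖ)
opF F = record
  { F₀ = F₀ ; F₁ = F₁ ; F₁-cong = F₁-cong ; identity = identity ; homo = homo }
  where open Functor F

record NatTrans {C : Category o h e} {D : Category o₁ h₁ e₁}
                (F G : Functor C D) : Set (o ⊔ h ⊔ h₁ ⊔ e₁) where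
  private
    module C = Category C
    module F = Functor F
    module G = Functor G
  open Category D
  field
    at      : ∀ X → F.F₀ X ⇒ G.F₀ X
    natural : ∀ {X Y} (f : X C.⇒ Y) → at Y ⊚ F.F₁ f ≈ G.F₁ f ⊚ at X

idN : {C : Category o h e} {D : Category o₁ h₁ e₁} (F : Functor C D) → NatTrans F F
idN {D = D} F = record
  { at      = λ _ → idm
  ; natural = λ _ → ≈.trans identityˡ (≈.sym identityʳ)
  }
  where open Category D

_∘N_ : {C : Category o h e} {D : Category o₁ h₁ e₁} {F G H : Functor C D} →
       NatTrans G H → NatTrans F G → NatTrans F H
_∘N_ {D = D} β α = record
  { at      = λ X → β.at X ⊚ α.at X
  ; natural = λ f →
      ≈.trans assoc
     (≈.trans (⊚-cong ≈.refl (α.natural f))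
     (≈.trans (≈.sym assoc)
     (≈.trans (⊚-cong (β.natural f) ≈.refl) assoc)))
  }
  where
  module α = NatTrans α
  module β = NatTrans β
  open Category D

record LeftAdjoint {C : Category o h e} {D : Category o₁ h₁ e₁} (U : Functor D C)
                   : Set (o ⊔ h ⊔ e ⊔ o₁ ⊔ h₁ ⊔ e₁) where
  private
    module C = Category C
    module D = Category D
    module U = Functor U
  field
    F      : Functor C D
    unit   : NatTrans (idF C) (U ∘F F)
    counit : NatTrans (F ∘F U) (idF D)
  private
    module F = Functor F
    module η = NatTrans unit
    module ε = NatTrans counit
  field
    triangleˡ : ∀ X → ε.at (F.F₀ X) D.⊚ F.F₁ (η.at X) D.≈ D.idm
    triangleʳ : ∀ Y → U.F₁ (ε.at Y) C.⊚ η.at (U.F₀ Y) C.≈ C.idm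

record IsTerminal (C : Category o h e) (T : Category.Obj C) : Set (o ⊔ h ⊔ e) where
  open Category C
  field
    !        : ∀ {X} → X ⇒ T
    !-unique : ∀ {X} (f : X ⇒ T) → ! ≈ f

record IsProduct (C : Category o h e) {A B P : Category.Obj C}
                 (π₁ : Category._⇒_ C P A) (π₂ : Category._⇒_ C P B)
                 : Set (o ⊔ h ⊔ e) where
  open Category C
  field
    ⟨_,_⟩    : ∀ {X} → X ⇒ A → X ⇒ B → X ⇒ P
    project₁ : ∀ {X} {f : X ⇒ A} {g : X ⇒ B} → π₁ ⊚ ⟨ f , g ⟩ ≈ f
    project₂ : ∀ {X} {f : X ⇒ A} {g : X ⇒ B} → π₂ ⊚ ⟨ f , g ⟩ ≈ g
    unique   : ∀ {X} {f : X ⇒ A} {g : X ⇒ B} {k : X ⇒ P} →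
               π₁ ⊚ k ≈ f → π₂ ⊚ k ≈ g → ⟨ f , g ⟩ ≈ k

record FPCategory (o h e : Level) : Set (suc (o ⊔ h ⊔ e)) where
  infixr 7 _×_
  field
    category : Category o h e
  open Category category public
  field
    𝟙          : Obj
    isTerminal : IsTerminal category 𝟙
    _×_        : Obj → Obj → Obj
    π₁         : ∀ {A B} → A × B ⇒ A
    π₂         : ∀ {A B} → A × B ⇒ B
    isProduct  : ∀ {A B} → IsProduct category (π₁ {A} {B}) π₂

  open module Product {A B} = IsProduct (isProduct {A} {B}) public
    using (⟨_,_⟩; project₁; project₂; unique)

  _×id : ∀ {X X′ Y} → X′ ⇒ X → X′ × Y ⇒ X × Y
  f ×id = ⟨ f ⊚ π₁ , π₂ ⟩

-- Preservation means sending product diagrams to product diagrams; the chosen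
-- products need not be preserved on the nose.
record FPFunctor (C : FPCategory o h e) (D : FPCategory o₁ h₁ e₁)
                 : Set (o ⊔ h ⊔ e ⊔ o₁ ⊔ h₁ ⊔ e₁) where
  private
    module C = FPCategory C
    module D = FPCategory D
  field
    functor : Functor C.category D.category
  open Functor functor public
  field
    preserves-𝟙 : ∀ {T} → IsTerminal C.category T → IsTerminal D.category (F₀ T)
    preserves-× : ∀ {A B P} {p : P C.⇒ A} {q : P C.⇒ B} →
                  IsProduct C.category p q → IsProduct D.category (F₁ p) (F₁ q)

  -- The inverse of the canonical map F₀ (X × Y) ⇒ F₀ X × F₀ Y.
  merge : ∀ X Y → F₀ X D.× F₀ Y D.⇒ F₀ (X C.× Y)
  merge X Y = IsProduct.⟨_,_⟩ (preserves-× (C.isProduct {X} {Y})) D.π₁ D.π₂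

idFP : (C : FPCategory o h e) → FPFunctor C C
idFP C = record
  { functor = idF (FPCategory.category C) ; preserves-𝟙 = id ; preserves-× = id }

_∘FP_ : {C : FPCategory o h e} {D : FPCategory o₁ h₁ e₁} {E : FPCategory o₂ h₂ e₂} →
        FPFunctor D E → FPFunctor C D → FPFunctor C E
N ∘FP M = record
  { functor     = N.functor ∘F M.functor
  ; preserves-𝟙 = N.preserves-𝟙 ∘ M.preserves-𝟙
  ; preserves-× = N.preserves-× ∘ M.preserves-×
  }
  where
  module M = FPFunctor M
  module N = FPFunctor N

record BooleanHom (A B : BooleanAlgebra ℓ ℓ) : Set ℓ where
  private
    module A = BooleanAlgebra A
    module B = BooleanAlgebra B
  field
    ⟦_⟧                   : A.Carrier → B.Carrier
    isLatticeHomomorphism : IsLatticeHomomorphism A.rawLattice B.rawLattice ⟦_⟧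
    ⊤-homo                : ⟦ A.⊤ ⟧ B.≈ B.⊤
    ⊥-homo                : ⟦ A.⊥ ⟧ B.≈ B.⊥
    ¬-homo                : ∀ x → ⟦ A.¬ x ⟧ B.≈ B.¬ ⟦ x ⟧
  open IsLatticeHomomorphism isLatticeHomomorphism public
    using (⟦⟧-cong; ∧-homo; ∨-homo)

BA : (ℓ : Level) → Category (suc ℓ) ℓ ℓ
BA ℓ = record
  { Obj           = BooleanAlgebra ℓ ℓ
  ; _⇒_           = BooleanHom
  ; _≈_           = λ {_} {B} f g → ∀ x → BooleanAlgebra._≈_ B (⟦ f ⟧ x) (⟦ g ⟧ x)
  ; idm           = λ {A} → let open BooleanAlgebra A in record
    { ⟦_⟧                   = id
    ; isLatticeHomomorphism = Identity.isLatticeHomomorphism rawLattice refl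
    ; ⊤-homo                = refl
    ; ⊥-homo                = refl
    ; ¬-homo                = λ _ → refl
    }
  ; _⊚_           = λ {A} {B} {C} g f → let open BooleanAlgebra C in record
    { ⟦_⟧                   = ⟦ g ⟧ ∘ ⟦ f ⟧
    ; isLatticeHomomorphism = Composition.isLatticeHomomorphism trans
                                (isLatticeHomomorphism f) (isLatticeHomomorphism g)
    ; ⊤-homo                = trans (⟦⟧-cong g (⊤-homo f)) (⊤-homo g)
    ; ⊥-homo                = trans (⟦⟧-cong g (⊥-homo f)) (⊥-homo g)
    ; ¬-homo                = λ x → trans (⟦⟧-cong g (¬-homo f x)) (¬-homo g (⟦ f ⟧ x))
    }
  ; isEquivalence = λ {_} {B} → let open BooleanAlgebra B in record
    { refl  = λ _ → refl
    ; sym   = λ p x → sym (p x)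
    ; trans = λ p q x → trans (p x) (q x)
    }
  ; ⊚-cong        = λ {_} {_} {C} {f} {_} {_} {g′} p q x →
                      BooleanAlgebra.trans C (⟦⟧-cong f (q x)) (p (⟦ g′ ⟧ x))
  ; assoc         = λ {_} {_} {_} {D} _ → BooleanAlgebra.refl D
  ; identityˡ     = λ {_} {B} _ → BooleanAlgebra.refl B
  ; identityʳ     = λ {_} {B} _ → BooleanAlgebra.refl B
  }
  where open BooleanHom

-- x ≤ y is x ≈ x ∧ y.
order : BooleanAlgebra ℓ ℓ → Poset ℓ ℓ ℓ
order A = LatticeProperties.poset (BooleanAlgebra.lattice A)

BooleanDoctrine : FPCategory o h e → (ℓ : Level) → Set (o ⊔ h ⊔ e ⊔ suc ℓ)
BooleanDoctrine C ℓ = Functor (FPCategory.category C ᵒᵖ) (BA ℓ)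

module Doctrine (C : FPCategory o h e) (P : BooleanDoctrine C ℓ) where
  open FPCategory C using (Obj; _⇒_)
  open Functor P public using (F₀)

  ∣_∣ : Obj → Set ℓ
  ∣ X ∣ = BooleanAlgebra.Carrier (F₀ X)

  Eq : ∀ X → Rel ∣ X ∣ ℓ
  Eq X = BooleanAlgebra._≈_ (F₀ X)

  Le : ∀ X → Rel ∣ X ∣ ℓ
  Le X = Poset._≤_ (order (F₀ X))

  reindex : ∀ {X Y} → X ⇒ Y → ∣ Y ∣ → ∣ X ∣
  reindex f = BooleanHom.⟦_⟧ (Functor.F₁ P f)

record IsFirstOrder (C : FPCategory o h e) (P : BooleanDoctrine C ℓ)
                    : Set (o ⊔ h ⊔ ℓ) where
  open FPCategory C
  open Doctrine C P
  field
    All            : ∀ Y X → ∣ X × Y ∣ → ∣ X ∣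
    All-monotone   : ∀ {X Y} → All Y X Preserves Le (X × Y) ⟶ Le X
    All-adjoint    : ∀ {X Y} →
                     Adjoint (Le X) (Le (X × Y)) (reindex π₁) (All Y X)
    beck-chevalley : ∀ {X X′ Y} (f : X′ ⇒ X) (a : ∣ X × Y ∣) →
                     Eq X′ (reindex f (All Y X a)) (All Y X′ (reindex (f ×id) a))

record FirstOrderDoctrine (C : FPCategory o h e) (ℓ : Level)
                          : Set (o ⊔ h ⊔ e ⊔ suc ℓ) where
  field
    doctrine     : BooleanDoctrine C ℓ
    isFirstOrder : IsFirstOrder C doctrine
  open Doctrine C doctrine public
  open IsFirstOrder isFirstOrder public

record DoctrineMorphism (C : FPCategory o h e) (D : FPCategory o₁ h₁ e₁)
                        (P : BooleanDoctrine C ℓ) (R : BooleanDoctrine D ℓ)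
                        : Set (o ⊔ h ⊔ e ⊔ o₁ ⊔ h₁ ⊔ e₁ ⊔ ℓ) where
  private
    module C = FPCategory C
    module P = Doctrine C P
    module R = Doctrine D R
  field
    base  : FPFunctor C D
    fibre : NatTrans P (R ∘F opF (FPFunctor.functor base))
  open FPFunctor base public

  apply : ∀ X → P.∣ X ∣ → R.∣ F₀ X ∣
  apply X = BooleanHom.⟦_⟧ (NatTrans.at fibre X)

composeD : {C : FPCategory o h e} {D : FPCategory o₁ h₁ e₁} {E : FPCategory o₂ h₂ e₂}
           {P : BooleanDoctrine C ℓ} {Q : BooleanDoctrine D ℓ} {R : BooleanDoctrine E ℓ} →
           DoctrineMorphism D E Q R → DoctrineMorphism C D P Q → DoctrineMorphism C E P R
composeD {ℓ = ℓ} {C = C} {P = P} {R = R} N M = record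
  { base  = N.base ∘FP M.base
  ; fibre = record
    { at      = λ X → NatTrans.at N.fibre (M.F₀ X) ⊚ NatTrans.at M.fibre X
    ; natural = λ f x → BooleanAlgebra.trans (Functor.F₀ R (N.F₀ (M.F₀ _)))
        (BooleanHom.⟦⟧-cong (NatTrans.at N.fibre _) (NatTrans.natural M.fibre f x))
        (NatTrans.natural N.fibre (M.F₁ f) (M.apply _ x))
    }
  }
  where
  module M = DoctrineMorphism M
  module N = DoctrineMorphism N
  open Category (BA ℓ) using (_⊚_)

-- Strict equality of morphisms (M , m) = (N , n): the two functors agree on
-- objects, and then on morphisms and on fibres modulo transport along that
-- agreement.
record _≐_ {C : FPCategory o h e} {D : FPCategory o₁ h₁ e₁}
           {P : BooleanDoctrine C ℓ} {R : BooleanDoctrine D ℓ}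
           (M N : DoctrineMorphism C D P R)
           : Set (o ⊔ h ⊔ e ⊔ o₁ ⊔ h₁ ⊔ e₁ ⊔ ℓ) where
  private
    module C = FPCategory C
    module D = FPCategory D
    module P = Doctrine C P
    module R = Doctrine D R
    module M = DoctrineMorphism M
    module N = DoctrineMorphism N
  field
    eq₀ : ∀ X → M.F₀ X ≡ N.F₀ X
    eq₁ : ∀ {X Y} (f : X C.⇒ Y) →
          subst₂ D._⇒_ (eq₀ X) (eq₀ Y) (M.F₁ f) D.≈ N.F₁ f
    eqᶠ : ∀ X (a : P.∣ X ∣) →
          R.Eq (N.F₀ X) (subst R.∣_∣ (eq₀ X) (M.apply X a)) (N.apply X a)

-- The equation m_X ∘ (∀Y)_X = (∀ M Y)_{M X} ∘ m_{X × Y} tacitly identifies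
-- M (X × Y) with M X × M Y; here the identification is reindexing along merge.
IsFirstOrderMorphism : (C : FPCategory o h e) (D : FPCategory o₁ h₁ e₁)
                       (P : FirstOrderDoctrine C ℓ) (R : FirstOrderDoctrine D ℓ) →
                       DoctrineMorphism C D (FirstOrderDoctrine.doctrine P)
                                            (FirstOrderDoctrine.doctrine R) →
                       Set (o ⊔ ℓ)
IsFirstOrderMorphism C D P R M =
  ∀ X Y (a : P.∣ X × Y ∣) →
  R.Eq (F₀ X) (apply X (P.All Y X a))
              (R.All (F₀ Y) (F₀ X) (R.reindex (merge X Y) (apply (X × Y) a)))
  where
  module P = FirstOrderDoctrine P
  module R = FirstOrderDoctrine R
  open FPCategory C using (_×_)
  open DoctrineMorphism M

record FirstOrderMorphism (C : FPCategory o h e) (D : FPCategory o₁ h₁ e₁)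
                          (P : FirstOrderDoctrine C ℓ) (R : FirstOrderDoctrine D ℓ)
                          : Set (o ⊔ h ⊔ e ⊔ o₁ ⊔ h₁ ⊔ e₁ ⊔ ℓ) where
  field
    morphism             : DoctrineMorphism C D (FirstOrderDoctrine.doctrine P)
                                                (FirstOrderDoctrine.doctrine R)
    isFirstOrderMorphism : IsFirstOrderMorphism C D P R morphism

-- The test doctrines R live over base categories of arbitrary size (o , h , e),
-- while their fibres are objects of the same category BA ℓ as those of P.
IsQuantifierCompletion :
  (o h e : Level) {C : FPCategory o₁ h₁ e₁} {C′ : FPCategory o₂ h₂ e₂}
  (P : BooleanDoctrine C ℓ) (Q : FirstOrderDoctrine C′ ℓ)
  (I : DoctrineMorphism C C′ P (FirstOrderDoctrine.doctrine Q)) →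
  Set (suc (o ⊔ h ⊔ e ⊔ ℓ) ⊔ o₁ ⊔ h₁ ⊔ e₁ ⊔ o₂ ⊔ h₂ ⊔ e₂)
IsQuantifierCompletion {ℓ = ℓ} o h e {C} {C′} P Q I =
  (D : FPCategory o h e) (R : FirstOrderDoctrine D ℓ)
  (M : DoctrineMorphism C D P (FirstOrderDoctrine.doctrine R)) →
  Σ (FirstOrderMorphism C′ D Q R) λ N →
    (M ≐ composeD (morphism N) I) and
    ((N′ : FirstOrderMorphism C′ D Q R) →
       M ≐ composeD (morphism N′) I → morphism N ≐ morphism N′)
  where open FirstOrderMorphism

-- Smallness of C is expressed by placing its objects and morphisms in the same
-- universe as the carriers of the Boolean algebras.
module _ (C : FPCategory ℓ ℓ ℓ) where
  open FPCategory C using (category; _×_)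

  Doct-BA : Category (suc ℓ) ℓ ℓ
  Doct-BA = record
    { Obj           = BooleanDoctrine C ℓ
    ; _⇒_           = NatTrans
    ; _≈_           = λ α β → ∀ X → at α X ≈ at β X
    ; idm           = λ {P} → idN P
    ; _⊚_           = _∘N_
    ; isEquivalence = record
      { refl  = λ {α} X → ≈.refl {x = at α X}
      ; sym   = λ {α} {β} p X → ≈.sym {x = at α X} {at β X} (p X)
      ; trans = λ {α} {β} {γ} p q X →
          ≈.trans {i = at α X} {at β X} {at γ X} (p X) (q X)
      }
    ; ⊚-cong        = λ {_} {_} {_} {α} {α′} {β} {β′} p q X →
                        ⊚-cong {f = at α X} {at α′ X} {at β X} {at β′ X} (p X) (q X)
    ; assoc         = λ {_} {_} {_} {_} {α} {β} {γ} X →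
                        assoc {f = at α X} {at β X} {at γ X}
    ; identityˡ     = λ {_} {_} {α} X → identityˡ {f = at α X}
    ; identityʳ     = λ {_} {_} {α} X → identityʳ {f = at α X}
    }
    where
    open Category (BA ℓ)
    open NatTrans

  record FirstOrderTransformation (P R : FirstOrderDoctrine C ℓ) : Set ℓ where
    private
      module P = FirstOrderDoctrine P
      module R = FirstOrderDoctrine R
    field
      transformation : NatTrans P.doctrine R.doctrine
    open NatTrans transformation public

    apply : ∀ X → P.∣ X ∣ → R.∣ X ∣
    apply X = BooleanHom.⟦_⟧ (at X)

    field
      preserves-All : ∀ X Y (a : P.∣ X × Y ∣) →
                      R.Eq X (apply X (P.All Y X a)) (R.All Y X (apply (X × Y) a))

  Doct-∀∃BA : Category (suc ℓ) ℓ ℓ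
  Doct-∀∃BA = record
    { Obj           = FirstOrderDoctrine C ℓ
    ; _⇒_           = FirstOrderTransformation
    ; _≈_           = λ α β → transformation α ≈ transformation β
    ; idm           = λ {P} → record
      { transformation = idN (doctrine P)
      ; preserves-All  = λ X _ _ → BooleanAlgebra.refl (F₀ P X)
      }
    ; _⊚_           = λ {P} {Q} {R} β α → record
      { transformation = transformation β ∘N transformation α
      ; preserves-All  = λ X Y a → BooleanAlgebra.trans (F₀ R X)
          (BooleanHom.⟦⟧-cong (at β X) (preserves-All α X Y a))
          (preserves-All β X Y (apply α (X × Y) a))
      }
    ; isEquivalence = record
      { refl  = λ {α} → ≈.refl {x = transformation α}
      ; sym   = λ {α} {β} → ≈.sym {x = transformation α} {transformation β}
      ; trans = λ {α} {β} {γ} →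
          ≈.trans {i = transformation α} {transformation β} {transformation γ}
      }
    ; ⊚-cong        = λ {_} {_} {_} {α} {α′} {β} {β′} →
        ⊚-cong {f = transformation α} {transformation α′}
               {transformation β} {transformation β′}
    ; assoc         = λ {_} {_} {_} {_} {α} {β} {γ} →
        assoc {f = transformation α} {transformation β} {transformation γ}
    ; identityˡ     = λ {_} {_} {α} → identityˡ {f = transformation α}
    ; identityʳ     = λ {_} {_} {α} → identityʳ {f = transformation α}
    }
    where
    open Category Doct-BA
    open FirstOrderDoctrine using (doctrine; F₀)
    open FirstOrderTransformation

  Forgetful : Functor Doct-∀∃BA Doct-BA
  Forgetful = record
    { F₀       = FirstOrderDoctrine.doctrine
    ; F₁       = FirstOrderTransformation.transformation
    ; F₁-cong  = id
    ; identity = λ {P} → ≈.refl {x = idN (FirstOrderDoctrine.doctrine P)}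
    ; homo     = λ {_} {_} {_} {α} {β} →
        ≈.refl {x = FirstOrderTransformation.transformation β ∘N
                    FirstOrderTransformation.transformation α}
    }
    where open Category Doct-BA

  -- A natural transformation between doctrines over C, as a morphism lying over
  -- the identity functor.
  overIdentity : {P R : BooleanDoctrine C ℓ} → NatTrans P R → DoctrineMorphism C C P R
  overIdentity α = record
    { base  = idFP C
    ; fibre = record { at = NatTrans.at α ; natural = NatTrans.natural α }
    }

  IsComponentwiseInjective : {P R : BooleanDoctrine C ℓ} → NatTrans P R → Set ℓ
  IsComponentwiseInjective {P} {R} α =
    ∀ X → Injective (Doctrine.Eq C P X) (Doctrine.Eq C R X) (BooleanHom.⟦_⟧ (NatTrans.at α X))

{-# OPTIONS --safe #-}

-- The left adjoint sends P to the first-order formulas over the atoms of P, modulo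
-- derivability in classical logic. Its unit reflects entailment between atoms over X₀
-- because P maps into the doctrine Y ↦ B^(X₀ ⇒ Y), where B is the completion of the
-- Boolean algebra P X₀: there ∀ is a meet over the morphisms X₀ ⇒ Y, so adjunction and
-- Beck-Chevalley are immediate, and an atom p is recovered from its value at the
-- identity of X₀. Given (M , m) : P → R, the doctrine R ∘ Mᵒᵖ over C is first-order, with
-- ∀ taken along F₀ X × F₀ Y ≅ F₀ (X × Y), so the completion property over varying bases
-- is the adjunction over C applied to m.
module Submission where

open import Level using (Level)
open import Data.Product.Base using (_,_; proj₁; proj₂) renaming (_×_ to _and_)
open import Relation.Binary.Core using (Rel)
open import Relation.Binary.Definitions using (Reflexive; Transitive)
open import Relation.Binary.Bundles using (Setoid)
import Relation.Binary.Lattice as Order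
import Relation.Binary.Lattice.Properties.Lattice as OrderLatticeProperties
import Relation.Binary.Lattice.Properties.DistributiveLattice as OrderDistributiveProperties
import Relation.Binary.Lattice.Properties.HeytingAlgebra as HeytingProperties
import Relation.Binary.Lattice.Properties.MeetSemilattice as MeetProperties
import Relation.Binary.Reasoning.Setoid as SetoidReasoning
open import Relation.Binary.PropositionalEquality as ≡ using (_≡_; subst; subst₂)
open import Algebra.Core using (Op₁; Op₂)
open import Algebra.Lattice.Bundles using (BooleanAlgebra)
import Algebra.Lattice.Properties.BooleanAlgebra as BooleanAlgebraProperties
open import Defs

private
  variable
    ℓ o h e o₁ h₁ e₁ : Level

-- Boolean algebras: presentation by a preorder, order, homomorphisms.

module PreorderedBoolean {c ℓ} {A : Set c} (_≤_ : Rel A ℓ)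
  (refl : Reflexive _≤_) (trans : Transitive _≤_)
  (_∧_ : Op₂ A) (¬_ : Op₁ A) (⊥ : A)
  (∧-lowerˡ : ∀ {x y} → (x ∧ y) ≤ x)
  (∧-lowerʳ : ∀ {x y} → (x ∧ y) ≤ y)
  (∧-greatest : ∀ {x y z} → z ≤ x → z ≤ y → z ≤ (x ∧ y))
  (¬-intro : ∀ {x y} → (x ∧ y) ≤ ⊥ → x ≤ (¬ y))
  (¬-elim : ∀ {x} → (x ∧ (¬ x)) ≤ ⊥)
  (¬¬-elim : ∀ {x} → (¬ (¬ x)) ≤ x)
  where

  infix 4 _≃_
  -- Mutual inequality plays the part of a quotient: as a setoid equality it turns the preorder into
  -- a partial order on the same carrier.
  _≃_ : Rel A ℓ
  x ≃ y = x ≤ y and y ≤ x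

  private
    contradiction : ∀ {x y} → x ≤ y → x ≤ (¬ y) → x ≤ ⊥
    contradiction p q = trans (∧-greatest p q) ¬-elim

    by-contradiction : ∀ {x y} → (x ∧ (¬ y)) ≤ ⊥ → x ≤ y
    by-contradiction p = trans (¬-intro p) ¬¬-elim

    ¬-antitone : ∀ {x y} → x ≤ y → (¬ y) ≤ (¬ x)
    ¬-antitone p = ¬-intro (contradiction (trans ∧-lowerʳ p) ∧-lowerˡ)

    -- Join, implication and top are classical abbreviations in `∧`, `¬` and `⊥`. Implication is
    -- included because its residuation is what yields the two distributive laws of
    -- `booleanAlgebra`.
    heytingAlgebra : Order.HeytingAlgebra c ℓ ℓ
    heytingAlgebra = record
      { Carrier = A
      ; _≈_ = _≃_
      ; _≤_ = _≤_
      ; _∨_ = λ x y → ¬ ((¬ x) ∧ (¬ y))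
      ; _∧_ = _∧_
      ; _⇨_ = λ x y → ¬ (x ∧ (¬ y))
      ; ⊤ = ¬ ⊥
      ; ⊥ = ⊥
      ; isHeytingAlgebra = record
        { isBoundedLattice = record
          { isLattice = record
            { isPartialOrder = record
              { isPreorder = record
                { isEquivalence = record
                  { refl  = refl , refl
                  ; sym   = λ (p , q) → q , p
                  ; trans = λ (p , q) (r , s) → trans p r , trans s q
                  }
                ; reflexive = proj₁
                ; trans     = trans
                }
              ; antisym = _,_
              }
            ; supremum = λ x y →
                ¬-intro (contradiction ∧-lowerˡ (trans ∧-lowerʳ ∧-lowerˡ)) ,
                ¬-intro (contradiction ∧-lowerˡ (trans ∧-lowerʳ ∧-lowerʳ)) ,
                λ z p q → by-contradiction
                  (contradiction
                    (trans ∧-lowerʳ (∧-greatest (¬-antitone p) (¬-antitone q)))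
                    ∧-lowerˡ)
            ; infimum = λ x y → ∧-lowerˡ , ∧-lowerʳ , λ _ → ∧-greatest
            }
          ; maximum = λ _ → ¬-intro ∧-lowerʳ
          ; minimum = λ _ → by-contradiction ∧-lowerˡ
          }
        ; exponential = λ w x y →
            (λ p → ¬-intro (contradiction
              (trans (∧-greatest ∧-lowerˡ (trans ∧-lowerʳ ∧-lowerˡ)) p)
              (trans ∧-lowerʳ ∧-lowerʳ))) ,
            (λ p → by-contradiction (contradiction
              (∧-greatest (trans ∧-lowerˡ ∧-lowerʳ) ∧-lowerʳ)
              (trans ∧-lowerˡ (trans ∧-lowerˡ p))))
        }
      }

    module H = Order.HeytingAlgebra heytingAlgebra
    module HP = HeytingProperties heytingAlgebra
    module LP = OrderLatticeProperties H.lattice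
    module DP = OrderDistributiveProperties HP.distributiveLattice

  booleanAlgebra : BooleanAlgebra c ℓ
  booleanAlgebra = record
    { Carrier = A
    ; _≈_ = _≃_
    ; _∨_ = H._∨_
    ; _∧_ = _∧_
    ; ¬_  = ¬_
    ; ⊤   = H.⊤
    ; ⊥   = ⊥
    ; isBooleanAlgebra = record
      { isDistributiveLattice = record
        { isLattice   = LP.isAlgLattice
        ; ∨-distrib-∧ = DP.∨-distrib-∧
        ; ∧-distrib-∨ = DP.∧-distrib-∨
        }
      ; ∨-complement =
          (λ x → H.maximum _ , ¬-intro (contradiction (trans ∧-lowerʳ ∧-lowerʳ)
                                                      (trans ∧-lowerʳ ∧-lowerˡ))) ,
          (λ x → H.maximum _ , ¬-intro (contradiction (trans ∧-lowerʳ ∧-lowerˡ)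
                                                      (trans ∧-lowerʳ ∧-lowerʳ)))
      ; ∧-complement =
          (λ x → contradiction ∧-lowerʳ ∧-lowerˡ , H.minimum _) ,
          (λ x → ¬-elim , H.minimum _)
      ; ¬-cong = λ (p , q) → ¬-antitone q , ¬-antitone p
      }
    }

module BooleanOrder {b₁ b₂} (B : BooleanAlgebra b₁ b₂) where
  open BooleanAlgebra B
  open BooleanAlgebraProperties B
  private module L = Order.Lattice ∨-∧-orderTheoreticLattice
  open L public using (_≤_; x∧y≤x; x∧y≤y; ∧-greatest)
    renaming (refl to ≤-refl; trans to ≤-trans; antisym to ≤-antisym; reflexive to ≤-reflexive)

  ⊥-min : ∀ {x} → ⊥ ≤ x
  ⊥-min = sym (∧-zeroˡ _)

  ∧-monotonic : ∀ {x x′ y y′} → x ≤ x′ → y ≤ y′ → x ∧ y ≤ x′ ∧ y′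
  ∧-monotonic = MeetProperties.∧-monotonic L.meetSemilattice

  -- Splitting `x` along `y ∨ ¬ y` leaves only `x ∧ ¬ y`, and `x ≈ x ∧ ¬ y` is what the inequality
  -- means.
  ∧≤⊥⇒≤¬ : ∀ {x y} → x ∧ y ≤ ⊥ → x ≤ ¬ y
  ∧≤⊥⇒≤¬ {x} {y} p = begin
    x                  ≈⟨ ∧-identityʳ x ⟨
    x ∧ ⊤              ≈⟨ ∧-congˡ (∨-complementʳ y) ⟨
    x ∧ (y ∨ ¬ y)      ≈⟨ ∧-distribˡ-∨ x y (¬ y) ⟩
    x ∧ y ∨ x ∧ ¬ y    ≈⟨ ∨-congʳ (≤-antisym p ⊥-min) ⟩
    ⊥ ∨ x ∧ ¬ y        ≈⟨ ∨-identityˡ _ ⟩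
    x ∧ ¬ y            ∎
    where open SetoidReasoning setoid

  ∧¬≤⊥⇒≤ : ∀ {x y} → x ∧ ¬ y ≤ ⊥ → x ≤ y
  ∧¬≤⊥⇒≤ p = ≤-trans (∧≤⊥⇒≤¬ p) (≤-reflexive (¬-involutive _))

module _ {A B : BooleanAlgebra ℓ ℓ} where
  private
    module A  = BooleanAlgebra A
    module B  = BooleanAlgebra B
    module AP = BooleanAlgebraProperties A
    module BP = BooleanAlgebraProperties B
    module A≤ = BooleanOrder A
    module B≤ = BooleanOrder B

  monotone : (f : BooleanHom A B) → ∀ {x y} → x A≤.≤ y →
             BooleanHom.⟦_⟧ f x B≤.≤ BooleanHom.⟦_⟧ f y
  monotone f p = B.trans (⟦⟧-cong p) (∧-homo _ _)
    where open BooleanHom f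

  -- Meet and negation generate the rest: joins come from De Morgan's laws, `⊥` is `⊥ ∧ ¬ ⊥`, and
  -- `⊤` is `¬ ⊥`.
  ∧-¬-booleanHom : (f : A.Carrier → B.Carrier) →
                   (∀ {x y} → x A.≈ y → f x B.≈ f y) →
                   (∀ x y → f (x A.∧ y) B.≈ (f x B.∧ f y)) →
                   (∀ x → f (A.¬ x) B.≈ (B.¬ f x)) →
                   BooleanHom A B
  ∧-¬-booleanHom f cong ∧-homo ¬-homo = record
    { ⟦_⟧ = f
    ; isLatticeHomomorphism = record
      { isRelHomomorphism = record { cong = cong }
      ; ∧-homo = ∧-homo
      ; ∨-homo = λ x y → begin
          f (x A.∨ y)                          ≈⟨ cong (AP.¬-involutive _) ⟨
          f (A.¬ A.¬ (x A.∨ y))                ≈⟨ cong (A.¬-cong (AP.deMorgan₂ x y)) ⟩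
          f (A.¬ ((A.¬ x) A.∧ (A.¬ y)))        ≈⟨ ¬-homo _ ⟩
          B.¬ f ((A.¬ x) A.∧ (A.¬ y))          ≈⟨ B.¬-cong (∧-homo _ _) ⟩
          B.¬ (f (A.¬ x) B.∧ f (A.¬ y))        ≈⟨ BP.deMorgan₁ _ _ ⟩
          (B.¬ f (A.¬ x)) B.∨ (B.¬ f (A.¬ y))  ≈⟨ B.∨-cong (back x) (back y) ⟩
          f x B.∨ f y                          ∎
      }
    ; ⊤-homo = begin
        f A.⊤        ≈⟨ cong AP.¬⊥≈⊤ ⟨
        f (A.¬ A.⊥)  ≈⟨ ¬-homo _ ⟩
        B.¬ f A.⊥    ≈⟨ B.¬-cong ⊥-homo ⟩
        B.¬ B.⊥      ≈⟨ BP.¬⊥≈⊤ ⟩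
        B.⊤          ∎
    ; ⊥-homo = ⊥-homo
    ; ¬-homo = ¬-homo
    }
    where
    open SetoidReasoning B.setoid

    back : ∀ x → (B.¬ f (A.¬ x)) B.≈ f x
    back x = B.trans (B.¬-cong (¬-homo x)) (BP.¬-involutive _)

    ⊥-homo : f A.⊥ B.≈ B.⊥
    ⊥-homo = begin
      f A.⊥                  ≈⟨ cong (A.∧-complementʳ A.⊥) ⟨
      f (A.⊥ A.∧ (A.¬ A.⊥))  ≈⟨ ∧-homo _ _ ⟩
      f A.⊥ B.∧ f (A.¬ A.⊥)  ≈⟨ B.∧-cong B.refl (¬-homo _) ⟩
      f A.⊥ B.∧ (B.¬ f A.⊥)  ≈⟨ B.∧-complementʳ _ ⟩
      B.⊥                    ∎

-- Adjunctions and universal arrows.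

hom-setoid : (C : Category o h e) (A B : Category.Obj C) → Setoid h e
hom-setoid C A B = record { isEquivalence = Category.isEquivalence C {A} {B} }

module HomReasoning (C : Category o h e) {A B : Category.Obj C} where
  open SetoidReasoning (hom-setoid C A B) public

module _ {C : Category o h e} {D : Category o₁ h₁ e₁} (U : Functor D C) where
  private
    module C = Category C
    module D = Category D
    module U = Functor U

  -- The functor laws, naturality of the counit and the left triangle all compare arrows out of some
  -- `F₀ P`, so `unique` reduces each to a computation after `η P`. Naturality of the unit and the
  -- right triangle are instances of the equation for `extend`.
  leftAdjoint-from-universal-arrows :
    (F₀ : C.Obj → D.Obj)
    (η : ∀ P → P C.⇒ U.F₀ (F₀ P))
    (extend : ∀ {P G} → P C.⇒ U.F₀ G → F₀ P D.⇒ G) →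
    (∀ {P G} (m : P C.⇒ U.F₀ G) → U.F₁ (extend m) C.⊚ η P C.≈ m) →
    (∀ {P G} (S T : F₀ P D.⇒ G) → U.F₁ S C.⊚ η P C.≈ U.F₁ T C.⊚ η P → S D.≈ T) →
    LeftAdjoint U
  leftAdjoint-from-universal-arrows F₀ η extend extend-η unique = record
    { F = record
      { F₀       = F₀
      ; F₁       = map
      ; F₁-cong  = λ {P} {Q} {f} {g} p → unique _ _ (begin
          U.F₁ (map f) C.⊚ η P  ≈⟨ extend-η _ ⟩
          η Q C.⊚ f             ≈⟨ C.⊚-cong C.≈.refl p ⟩
          η Q C.⊚ g             ≈⟨ extend-η _ ⟨
          U.F₁ (map g) C.⊚ η P  ∎)
      ; identity = λ {P} → unique _ _ (begin
          U.F₁ (map C.idm) C.⊚ η P  ≈⟨ extend-η _ ⟩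
          η P C.⊚ C.idm             ≈⟨ C.identityʳ ⟩
          η P                       ≈⟨ C.identityˡ ⟨
          C.idm C.⊚ η P             ≈⟨ C.⊚-cong U.identity C.≈.refl ⟨
          U.F₁ D.idm C.⊚ η P        ∎)
      ; homo     = λ {P} {Q} {R} {f} {g} → unique _ _ (begin
          U.F₁ (map (g C.⊚ f)) C.⊚ η P                  ≈⟨ extend-η _ ⟩
          η R C.⊚ g C.⊚ f                               ≈⟨ C.assoc ⟨
          (η R C.⊚ g) C.⊚ f                             ≈⟨ C.⊚-cong (extend-η _) C.≈.refl ⟨
          (U.F₁ (map g) C.⊚ η Q) C.⊚ f                  ≈⟨ C.assoc ⟩
          U.F₁ (map g) C.⊚ η Q C.⊚ f                    ≈⟨ C.⊚-cong C.≈.refl (extend-η _) ⟨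
          U.F₁ (map g) C.⊚ U.F₁ (map f) C.⊚ η P         ≈⟨ U-⊚ _ _ _ ⟨
          U.F₁ (map g D.⊚ map f) C.⊚ η P                ∎)
      }
    ; unit   = record { at = η ; natural = λ f → C.≈.sym (extend-η _) }
    ; counit = record
      { at      = counit
      ; natural = λ {G} {H} k → unique _ _ (begin
          U.F₁ (counit H D.⊚ map (U.F₁ k)) C.⊚ η (U.F₀ G)        ≈⟨ U-⊚ _ _ _ ⟩
          U.F₁ (counit H) C.⊚ U.F₁ (map (U.F₁ k)) C.⊚ η (U.F₀ G)
            ≈⟨ C.⊚-cong C.≈.refl (extend-η _) ⟩
          U.F₁ (counit H) C.⊚ η (U.F₀ H) C.⊚ U.F₁ k              ≈⟨ C.assoc ⟨
          (U.F₁ (counit H) C.⊚ η (U.F₀ H)) C.⊚ U.F₁ k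
            ≈⟨ C.⊚-cong (extend-η _) C.≈.refl ⟩
          C.idm C.⊚ U.F₁ k                                       ≈⟨ C.identityˡ ⟩
          U.F₁ k                                                 ≈⟨ C.identityʳ ⟨
          U.F₁ k C.⊚ C.idm
            ≈⟨ C.⊚-cong C.≈.refl (extend-η _) ⟨
          U.F₁ k C.⊚ U.F₁ (counit G) C.⊚ η (U.F₀ G)              ≈⟨ U-⊚ _ _ _ ⟨
          U.F₁ (k D.⊚ counit G) C.⊚ η (U.F₀ G)                   ∎)
      }
    ; triangleˡ = λ P → unique _ _ (begin
        U.F₁ (counit (F₀ P) D.⊚ map (η P)) C.⊚ η P               ≈⟨ U-⊚ _ _ _ ⟩
        U.F₁ (counit (F₀ P)) C.⊚ U.F₁ (map (η P)) C.⊚ η P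
          ≈⟨ C.⊚-cong C.≈.refl (extend-η _) ⟩
        U.F₁ (counit (F₀ P)) C.⊚ η (U.F₀ (F₀ P)) C.⊚ η P         ≈⟨ C.assoc ⟨
        (U.F₁ (counit (F₀ P)) C.⊚ η (U.F₀ (F₀ P))) C.⊚ η P
          ≈⟨ C.⊚-cong (extend-η _) C.≈.refl ⟩
        C.idm C.⊚ η P                                            ≈⟨ C.⊚-cong U.identity C.≈.refl ⟨
        U.F₁ D.idm C.⊚ η P                                       ∎)
    ; triangleʳ = λ G → extend-η C.idm
    }
    where
    open HomReasoning C

    map : ∀ {P Q} → P C.⇒ Q → F₀ P D.⇒ F₀ Q
    map f = extend (η _ C.⊚ f)

    counit : ∀ G → F₀ (U.F₀ G) D.⇒ G
    counit G = extend C.idm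

    U-⊚ : ∀ {X G H K} (g : H D.⇒ K) (f : G D.⇒ H) (k : X C.⇒ U.F₀ G) →
          U.F₁ (g D.⊚ f) C.⊚ k C.≈ U.F₁ g C.⊚ U.F₁ f C.⊚ k
    U-⊚ g f k = C.≈.trans (C.⊚-cong U.homo C.≈.refl) C.assoc

  module AdjointTranspose (A : LeftAdjoint U) where
    open LeftAdjoint A
    private
      module F = Functor F
      module η = NatTrans unit
      module ε = NatTrans counit

    transpose : ∀ {P G} → P C.⇒ U.F₀ G → F.F₀ P D.⇒ G
    transpose m = ε.at _ D.⊚ F.F₁ m

    -- Naturality moves `m` past the unit, and the right triangle cancels the counit. Together with
    -- `transpose-restriction`, this recovers the universal property of the unit for an arbitrary
    -- left adjoint, not only for the one built from formulas.
    transpose-unit : ∀ {P G} (m : P C.⇒ U.F₀ G) → U.F₁ (transpose m) C.⊚ η.at P C.≈ m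
    transpose-unit {P} {G} m = begin
      U.F₁ (ε.at G D.⊚ F.F₁ m) C.⊚ η.at P            ≈⟨ C.⊚-cong U.homo C.≈.refl ⟩
      (U.F₁ (ε.at G) C.⊚ U.F₁ (F.F₁ m)) C.⊚ η.at P   ≈⟨ C.assoc ⟩
      U.F₁ (ε.at G) C.⊚ U.F₁ (F.F₁ m) C.⊚ η.at P     ≈⟨ C.⊚-cong C.≈.refl (η.natural m) ⟨
      U.F₁ (ε.at G) C.⊚ η.at (U.F₀ G) C.⊚ m          ≈⟨ C.assoc ⟨
      (U.F₁ (ε.at G) C.⊚ η.at (U.F₀ G)) C.⊚ m        ≈⟨ C.⊚-cong (triangleʳ G) C.≈.refl ⟩
      C.idm C.⊚ m                                    ≈⟨ C.identityˡ ⟩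
      m                                              ∎
      where open HomReasoning C

    transpose-restriction : ∀ {P G} (T : F.F₀ P D.⇒ G) → transpose (U.F₁ T C.⊚ η.at P) D.≈ T
    transpose-restriction {P} {G} T = begin
      ε.at G D.⊚ F.F₁ (U.F₁ T C.⊚ η.at P)             ≈⟨ D.⊚-cong D.≈.refl F.homo ⟩
      ε.at G D.⊚ F.F₁ (U.F₁ T) D.⊚ F.F₁ (η.at P)      ≈⟨ D.assoc ⟨
      (ε.at G D.⊚ F.F₁ (U.F₁ T)) D.⊚ F.F₁ (η.at P)    ≈⟨ D.⊚-cong (ε.natural T) D.≈.refl ⟩
      (T D.⊚ ε.at (F.F₀ P)) D.⊚ F.F₁ (η.at P)         ≈⟨ D.assoc ⟩
      T D.⊚ ε.at (F.F₀ P) D.⊚ F.F₁ (η.at P)           ≈⟨ D.⊚-cong D.≈.refl (triangleˡ P) ⟩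
      T D.⊚ D.idm                                     ≈⟨ D.identityʳ ⟩
      T                                               ∎
      where open HomReasoning D

    unit-determines : ∀ {P G} (S T : F.F₀ P D.⇒ G) →
                      U.F₁ S C.⊚ η.at P C.≈ U.F₁ T C.⊚ η.at P → S D.≈ T
    unit-determines {P} S T p = begin
      S                                ≈⟨ transpose-restriction S ⟨
      transpose (U.F₁ S C.⊚ η.at P)    ≈⟨ D.⊚-cong D.≈.refl (F.F₁-cong p) ⟩
      transpose (U.F₁ T C.⊚ η.at P)    ≈⟨ transpose-restriction T ⟩
      T                                ∎
      where open HomReasoning D

-- Quantifiers, reindexing and transport in a first-order doctrine.

module FirstOrderProperties {D : FPCategory o h e} (R : FirstOrderDoctrine D ℓ) where
  open FPCategory D
  private
    module R = FirstOrderDoctrine R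
    module RA {X} = BooleanAlgebra (R.F₀ X)
    module R≤ {X} = BooleanOrder (R.F₀ X)
    module RF = Functor R.doctrine

  All-cong : ∀ {X Y} {a b : R.∣ X × Y ∣} → R.Eq _ a b → R.Eq X (R.All Y X a) (R.All Y X b)
  All-cong p = R≤.≤-antisym (R.All-monotone (R≤.≤-reflexive p))
                            (R.All-monotone (R≤.≤-reflexive (RA.sym p)))

  reindex-cong : ∀ {X Y} (f : X ⇒ Y) {a b : R.∣ Y ∣} → R.Eq Y a b →
                 R.Eq X (R.reindex f a) (R.reindex f b)
  reindex-cong f = BooleanHom.⟦⟧-cong (Functor.F₁ R.doctrine f)

  reindex-mono : ∀ {X Y} (f : X ⇒ Y) {a b : R.∣ Y ∣} → R.Le Y a b →
                 R.Le X (R.reindex f a) (R.reindex f b)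
  reindex-mono f = monotone (Functor.F₁ R.doctrine f)

  reindex-square : ∀ {X Y Y′ Z} {f : X ⇒ Y} {g : Y ⇒ Z} {f′ : X ⇒ Y′} {g′ : Y′ ⇒ Z} →
                   g ⊚ f ≈ g′ ⊚ f′ → ∀ a →
                   R.Eq X (R.reindex f (R.reindex g a)) (R.reindex f′ (R.reindex g′ a))
  reindex-square p a = RA.trans (RA.sym (RF.homo a)) (RA.trans (RF.F₁-cong p a) (RF.homo a))

  reindex-triangle : ∀ {X Y Z} {f : X ⇒ Y} {g : Y ⇒ Z} {k : X ⇒ Z} →
                     g ⊚ f ≈ k → ∀ a →
                     R.Eq X (R.reindex f (R.reindex g a)) (R.reindex k a)
  reindex-triangle p a = RA.trans (RA.sym (RF.homo a)) (RF.F₁-cong p a)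

  -- Turning equalities of objects into arrows replaces the transports of `_≐_` by reindexing, to
  -- which naturality and Beck-Chevalley apply.
  cast : ∀ {A B} → A ≡ B → A ⇒ B
  cast ≡.refl = idm

  cast-natural : ∀ {A A′ B B′} (p : A ≡ A′) (q : B ≡ B′) {f : A ⇒ B} {g : A′ ⇒ B′} →
                 subst₂ _⇒_ p q f ≈ g → cast q ⊚ f ≈ g ⊚ cast p
  cast-natural ≡.refl ≡.refl r = ≈.trans identityˡ (≈.trans r (≈.sym identityʳ))

  reindex-cast⁻ : ∀ {A B} (p : A ≡ B) {a : R.∣ A ∣} {b : R.∣ B ∣} →
                  R.Eq B (subst R.∣_∣ p a) b → R.Eq A a (R.reindex (cast p) b)
  reindex-cast⁻ ≡.refl r = RA.trans r (RA.sym (RF.identity _))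

  reindex-cast : ∀ {A B} (p : A ≡ B) {a : R.∣ A ∣} {b : R.∣ B ∣} →
                 R.Eq A a (R.reindex (cast p) b) → R.Eq B (subst R.∣_∣ p a) b
  reindex-cast ≡.refl r = RA.trans r (RF.identity _)

  -- Beck-Chevalley changes only the parameter object `X`. Changing the quantified object is
  -- possible here because the change is an equality, and for the trivial equality the pairing is
  -- the identity.
  All-cast : ∀ {X Y Y′} (p : Y ≡ Y′) (a : R.∣ X × Y′ ∣) →
             R.Eq X (R.All Y′ X a) (R.All Y X (R.reindex ⟨ π₁ , cast p ⊚ π₂ ⟩ a))
  All-cast ≡.refl a = All-cong (RA.sym (RA.trans
    (RF.F₁-cong (unique identityʳ (≈.trans identityʳ (≈.sym identityˡ))) a) (RF.identity a)))

-- The free first-order doctrine on a Boolean doctrine.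

module Free {C : FPCategory ℓ ℓ ℓ} (P : BooleanDoctrine C ℓ) where
  open FPCategory C
  private
    module P = Doctrine C P
    module PA {X} = BooleanAlgebra (P.F₀ X)
    module P₁ {X Y} (f : X ⇒ Y) = BooleanHom (Functor.F₁ P f)
    module P≤ {X} = BooleanOrder (P.F₀ X)

  infixr 7 _∧_
  infix  8 ¬_
  infixl 9 _[_]
  infix  4 _⊢_

  -- Substitution is a constructor rather than a recursive operation; how it meets the connectives
  -- and the quantifier is left to the rules of derivability.
  data Formula : Obj → Set ℓ where
    atom : ∀ {X} → P.∣ X ∣ → Formula X
    _∧_  : ∀ {X} → Formula X → Formula X → Formula X
    ¬_   : ∀ {X} → Formula X → Formula X
    all  : ∀ Y {X} → Formula (X × Y) → Formula X
    _[_] : ∀ {X Y} → Formula Y → X ⇒ Y → Formula X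

  ⊥ : ∀ {X} → Formula X
  ⊥ = atom PA.⊥

  -- The rules `all-[]`, `[]-∧`, `[]-¬`, `atom-∧` and `atom-¬` give one direction of an equivalence
  -- each; the opposite directions are derived in `doctrine`, `free` and `embed`.
  data _⊢_ : ∀ {X} → Formula X → Formula X → Set ℓ where
    refl      : ∀ {X} {a : Formula X} → a ⊢ a
    trans     : ∀ {X} {a b c : Formula X} → a ⊢ b → b ⊢ c → a ⊢ c
    ∧-elimˡ   : ∀ {X} {a b : Formula X} → a ∧ b ⊢ a
    ∧-elimʳ   : ∀ {X} {a b : Formula X} → a ∧ b ⊢ b
    ∧-intro   : ∀ {X} {a b c : Formula X} → c ⊢ a → c ⊢ b → c ⊢ a ∧ b
    ¬-intro   : ∀ {X} {a b : Formula X} → a ∧ b ⊢ ⊥ → a ⊢ ¬ b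
    ¬-elim    : ∀ {X} {a : Formula X} → a ∧ ¬ a ⊢ ⊥
    ¬¬-elim   : ∀ {X} {a : Formula X} → ¬ ¬ a ⊢ a
    all-intro : ∀ {X Y} {a : Formula X} {b : Formula (X × Y)} →
                a [ π₁ ] ⊢ b → a ⊢ all Y b
    all-elim  : ∀ {X Y} {b : Formula (X × Y)} → all Y b [ π₁ ] ⊢ b
    all-[]    : ∀ {X X′ Y} {b : Formula (X × Y)} {f : X′ ⇒ X} →
                all Y (b [ f ×id ]) ⊢ all Y b [ f ]
    atom-mono : ∀ {X} {p q : P.∣ X ∣} → P.Le X p q → atom p ⊢ atom q
    atom-∧    : ∀ {X} {p q : P.∣ X ∣} → atom p ∧ atom q ⊢ atom (p PA.∧ q)
    atom-¬    : ∀ {X} {p : P.∣ X ∣} → ¬ atom p ⊢ atom (PA.¬ p)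
    atom-[]   : ∀ {X Y} {f : X ⇒ Y} {p : P.∣ Y ∣} → atom p [ f ] ⊢ atom (P.reindex f p)
    []-atom   : ∀ {X Y} {f : X ⇒ Y} {p : P.∣ Y ∣} → atom (P.reindex f p) ⊢ atom p [ f ]
    []-mono   : ∀ {X Y} {f : X ⇒ Y} {a b : Formula Y} → a ⊢ b → a [ f ] ⊢ b [ f ]
    []-cong   : ∀ {X Y} {f g : X ⇒ Y} {a : Formula Y} → f ≈ g → a [ f ] ⊢ a [ g ]
    []-idm    : ∀ {X} {a : Formula X} → a [ idm ] ⊢ a
    idm-[]    : ∀ {X} {a : Formula X} → a ⊢ a [ idm ]
    []-⊚      : ∀ {X Y Z} {f : X ⇒ Y} {g : Y ⇒ Z} {a : Formula Z} →
                a [ g ⊚ f ] ⊢ a [ g ] [ f ]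
    ⊚-[]      : ∀ {X Y Z} {f : X ⇒ Y} {g : Y ⇒ Z} {a : Formula Z} →
                a [ g ] [ f ] ⊢ a [ g ⊚ f ]
    []-∧      : ∀ {X Y} {f : X ⇒ Y} {a b : Formula Y} → a [ f ] ∧ b [ f ] ⊢ (a ∧ b) [ f ]
    []-¬      : ∀ {X Y} {f : X ⇒ Y} {a : Formula Y} → ¬ (a [ f ]) ⊢ (¬ a) [ f ]

  private
    module B {X} = PreorderedBoolean (_⊢_ {X}) refl trans _∧_ ¬_ ⊥
      ∧-elimˡ ∧-elimʳ ∧-intro ¬-intro ¬-elim ¬¬-elim
    module B≤ {X} = BooleanOrder (B.booleanAlgebra {X})

  ≤⇒⊢ : ∀ {X} {a b : Formula X} → a B≤.≤ b → a ⊢ b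
  ≤⇒⊢ (p , _) = trans p ∧-elimʳ

  ⊢⇒≤ : ∀ {X} {a b : Formula X} → a ⊢ b → a B≤.≤ b
  ⊢⇒≤ p = ∧-intro refl p , ∧-elimˡ

  all-mono : ∀ {X Y} {a b : Formula (X × Y)} → a ⊢ b → all Y a ⊢ all Y b
  all-mono p = all-intro (trans all-elim p)

  doctrine : BooleanDoctrine C ℓ
  doctrine = record
    { F₀       = λ X → B.booleanAlgebra {X}
    ; F₁       = λ f → ∧-¬-booleanHom (_[ f ])
        (λ (p , q) → []-mono p , []-mono q)
        (λ a b → ∧-intro ([]-mono ∧-elimˡ) ([]-mono ∧-elimʳ) , []-∧)
        -- The contradiction is reached under the substitution: `[]-∧` gathers `a` and `¬ a`, and
        -- `⊥ [ f ]` is the atom on `P.reindex f` of bottom, which is bottom.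
        (λ a → ¬-intro (trans (∧-intro ∧-elimʳ ∧-elimˡ)
                 (trans []-∧ (trans ([]-mono ¬-elim) (trans atom-[]
                   (atom-mono (P≤.≤-reflexive (P₁.⊥-homo f))))))) , []-¬)
    ; F₁-cong  = λ p a → []-cong p , []-cong (≈.sym p)
    ; identity = λ a → []-idm , idm-[]
    ; homo     = λ a → []-⊚ , ⊚-[]
    }

  free : FirstOrderDoctrine C ℓ
  free = record
    { doctrine     = doctrine
    ; isFirstOrder = record
      { All            = λ Y X → all Y
      ; All-monotone   = λ p → ⊢⇒≤ (all-mono (≤⇒⊢ p))
      ; All-adjoint    = (λ p → ⊢⇒≤ (all-intro (≤⇒⊢ p))) ,
                         (λ p → ⊢⇒≤ (trans ([]-mono (≤⇒⊢ p)) all-elim))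
      ; beck-chevalley = λ f a →
          -- Since `f ⊚ π₁ ≈ π₁ ⊚ (f ×id)`, the weakening of `all Y a [ f ]` is `all Y a [ π₁ ]`
          -- substituted along `f ×id`, so `all-elim` applies inside the substitution.
          all-intro (trans ⊚-[] (trans ([]-cong (≈.sym project₁))
            (trans []-⊚ ([]-mono all-elim)))) , all-[]
      }
    }

  embed : NatTrans P doctrine
  embed = record
    { at = λ X → ∧-¬-booleanHom atom
        (λ p → atom-mono (P≤.≤-reflexive p) , atom-mono (P≤.≤-reflexive (PA.sym p)))
        (λ p q → ∧-intro (atom-mono (P≤.x∧y≤x p q)) (atom-mono (P≤.x∧y≤y p q)) , atom-∧)
        (λ p → ¬-intro (trans atom-∧ (atom-mono (P≤.≤-reflexive (PA.∧-complementˡ p)))) , atom-¬)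
    ; natural = λ f p → []-atom , atom-[]
    }

  module Extend (R : FirstOrderDoctrine C ℓ)
                (m : NatTrans P (FirstOrderDoctrine.doctrine R)) where
    private
      module R = FirstOrderDoctrine R
      module RA {X} = BooleanAlgebra (R.F₀ X)
      module R≤ {X} = BooleanOrder (R.F₀ X)
      module R₁ {X Y} (f : X ⇒ Y) = BooleanHom (Functor.F₁ R.doctrine f)
      module RF = Functor R.doctrine
      module m X = BooleanHom (NatTrans.at m X)

    ⟦_⟧ : ∀ {X} → Formula X → R.∣ X ∣
    ⟦ atom p ⟧  = m.⟦_⟧ _ p
    ⟦ a ∧ b ⟧   = ⟦ a ⟧ RA.∧ ⟦ b ⟧
    ⟦ ¬ a ⟧     = RA.¬ ⟦ a ⟧
    ⟦ all Y a ⟧ = R.All Y _ ⟦ a ⟧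
    ⟦ a [ f ] ⟧ = R.reindex f ⟦ a ⟧

    sound : ∀ {X} {a b : Formula X} → a ⊢ b → R.Le X ⟦ a ⟧ ⟦ b ⟧
    sound refl          = R≤.≤-refl
    sound (trans p q)   = R≤.≤-trans (sound p) (sound q)
    sound ∧-elimˡ       = R≤.x∧y≤x _ _
    sound ∧-elimʳ       = R≤.x∧y≤y _ _
    sound (∧-intro p q) = R≤.∧-greatest (sound p) (sound q)
    -- Bottom is an atom, so its value is the image of bottom under `m` and has to be identified
    -- with the bottom of `R`.
    sound (¬-intro p)   = R≤.∧≤⊥⇒≤¬ (R≤.≤-trans (sound p) (R≤.≤-reflexive (m.⊥-homo _)))
    sound ¬-elim        = R≤.≤-reflexive (RA.trans (RA.∧-complementʳ _) (RA.sym (m.⊥-homo _)))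
    sound ¬¬-elim       = R≤.≤-reflexive (BooleanAlgebraProperties.¬-involutive (R.F₀ _) _)
    sound (all-intro p) = proj₁ R.All-adjoint (sound p)
    sound all-elim      = proj₂ R.All-adjoint R≤.≤-refl
    sound (all-[] {b = b} {f}) = R≤.≤-reflexive (RA.sym (R.beck-chevalley f ⟦ b ⟧))
    sound (atom-mono p) = monotone (NatTrans.at m _) p
    sound atom-∧        = R≤.≤-reflexive (RA.sym (m.∧-homo _ _ _))
    sound atom-¬        = R≤.≤-reflexive (RA.sym (m.¬-homo _ _))
    sound (atom-[] {f = f} {p}) = R≤.≤-reflexive (RA.sym (NatTrans.natural m f p))
    sound ([]-atom {f = f} {p}) = R≤.≤-reflexive (NatTrans.natural m f p)
    sound ([]-mono {f = f} p)   = monotone (Functor.F₁ R.doctrine f) (sound p)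
    sound ([]-cong p)   = R≤.≤-reflexive (RF.F₁-cong p _)
    sound []-idm        = R≤.≤-reflexive (RF.identity _)
    sound idm-[]        = R≤.≤-reflexive (RA.sym (RF.identity _))
    sound []-⊚          = R≤.≤-reflexive (RF.homo _)
    sound ⊚-[]          = R≤.≤-reflexive (RA.sym (RF.homo _))
    sound ([]-∧ {f = f}) = R≤.≤-reflexive (RA.sym (R₁.∧-homo f _ _))
    sound ([]-¬ {f = f}) = R≤.≤-reflexive (RA.sym (R₁.¬-homo f _))

    -- `⟦_⟧` is defined clause by clause, so preservation of `∧`, `¬`, substitution and quantifiers
    -- is reflexivity; `sound` supplies compatibility with derivability.
    extend : FirstOrderTransformation C free R
    extend = record
      { transformation = record
        { at      = λ X → ∧-¬-booleanHom ⟦_⟧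
            (λ (p , q) → R≤.≤-antisym (sound p) (sound q))
            (λ a b → RA.refl) (λ a → RA.refl)
        ; natural = λ f a → RA.refl
        }
      ; preserves-All = λ X Y a → RA.refl
      }

  module _ (R : FirstOrderDoctrine C ℓ) (S T : FirstOrderTransformation C free R) where
    private
      module R = FirstOrderDoctrine R
      module RA {X} = BooleanAlgebra (R.F₀ X)
      module RP = FirstOrderProperties R
      module S = FirstOrderTransformation S
      module T = FirstOrderTransformation T
      module S₁ X = BooleanHom (S.at X)
      module T₁ X = BooleanHom (T.at X)

    -- Induction on formulas: every constructor other than `atom` is an operation that `S` and `T`
    -- both preserve, the substitution case being naturality.
    atoms-determine : (∀ X p → R.Eq X (S.apply X (atom p)) (T.apply X (atom p))) →
                      ∀ X a → R.Eq X (S.apply X a) (T.apply X a)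
    atoms-determine p X (atom q)  = p X q
    atoms-determine p X (a ∧ b)   = RA.trans (S₁.∧-homo X a b) (RA.trans
      (RA.∧-cong (atoms-determine p X a) (atoms-determine p X b)) (RA.sym (T₁.∧-homo X a b)))
    atoms-determine p X (¬ a)     = RA.trans (S₁.¬-homo X a) (RA.trans
      (RA.¬-cong (atoms-determine p X a)) (RA.sym (T₁.¬-homo X a)))
    atoms-determine p X (all Y a) = RA.trans (S.preserves-All X Y a) (RA.trans
      (RP.All-cong (atoms-determine p (X × Y) a)) (RA.sym (T.preserves-All X Y a)))
    atoms-determine p X (a [ f ]) = RA.trans (S.natural f a) (RA.trans
      (RP.reindex-cong f (atoms-determine p _ a))
      (RA.sym (T.natural f a)))

  -- Forces a f y: read in the model X₀ ⇒ - with truth values in the Boolean completion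
  -- of P X₀ (the subsets equal to their double orthogonal complement), the value of a at
  -- f contains y.
  module Forcing (X₀ : Obj) where
    open P≤ {X₀}
    Forces : ∀ {X} → Formula X → X₀ ⇒ X → P.∣ X₀ ∣ → Set ℓ
    Forces (atom p)  f y = y ≤ P.reindex f p
    Forces (a ∧ b)   f y = Forces a f y and Forces b f y
    Forces (¬ a)     f y = ∀ z → Forces a f z → y PA.∧ z ≤ PA.⊥
    Forces (all Y a) f y = ∀ g → Forces a ⟨ f , g ⟩ y
    Forces (a [ g ]) f y = Forces a (g ⊚ f) y

    private
      swap : ∀ {y z} → y PA.∧ z ≤ PA.⊥ → z PA.∧ y ≤ PA.⊥
      swap p = ≤-trans (≤-reflexive (PA.∧-comm _ _)) p

    -- Used for `¬-intro`, where two hypotheses forced at `y` and at `z` are brought to the common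
    -- lower bound `y ∧ z`.
    downward : ∀ {X} (a : Formula X) {f y z} → z ≤ y → Forces a f y → Forces a f z
    downward (atom p)  q r       = ≤-trans q r
    downward (a ∧ b)   q (r , s) = downward a q r , downward b q s
    downward (¬ a)     q r x s   = ≤-trans (∧-monotonic q ≤-refl) (r x s)
    downward (all Y a) q r g     = downward a q (r g)
    downward (a [ g ]) q r       = downward a q r

    -- This keeps the semantics classical and validates `¬¬-elim`: principal ideals are regular,
    -- orthogonal complements always are, and intersections inherit regularity.
    stable : ∀ {X} (a : Formula X) {f y} → Forces (¬ ¬ a) f y → Forces a f y
    -- The element tested is the complement of `P.reindex f p`, which is disjoint from everything
    -- below `P.reindex f p`.
    stable (atom p)  r     = ∧¬≤⊥⇒≤ (r _ λ z q → swap (≤-trans (∧-monotonic q ≤-refl)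
                               (≤-reflexive (PA.∧-complementʳ _))))
    stable (a ∧ b)   r     = stable a (λ z s → r z λ x (t , _) → s x t) ,
                             stable b (λ z s → r z λ x (_ , t) → s x t)
    stable (¬ a)     r z s = r z λ x t → swap (t z s)
    stable (all Y a) r g   = stable a λ z s → r z λ x t → s x (t g)
    stable (a [ g ]) r     = stable a r

    Forces-cong : ∀ {X} (a : Formula X) {f g y} → f ≈ g → Forces a f y → Forces a g y
    Forces-cong (atom p)  q r     = ≤-trans r (≤-reflexive (Functor.F₁-cong P q p))
    Forces-cong (a ∧ b)   q (r , s) = Forces-cong a q r , Forces-cong b q s
    Forces-cong (¬ a)     q r z s = r z (Forces-cong a (≈.sym q) s)
    Forces-cong (all Y a) q r g   = Forces-cong a
      (unique (≈.trans project₁ (≈.sym q)) project₂) (r g)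
    Forces-cong (a [ g ]) q r     = Forces-cong a (⊚-cong ≈.refl q) r

    forces-sound : ∀ {X} {a b : Formula X} → a ⊢ b → ∀ {f y} → Forces a f y → Forces b f y
    forces-sound refl          r = r
    forces-sound (trans p q)   r = forces-sound q (forces-sound p r)
    forces-sound ∧-elimˡ       (r , _) = r
    forces-sound ∧-elimʳ       (_ , r) = r
    forces-sound (∧-intro p q) r = forces-sound p r , forces-sound q r
    forces-sound (¬-intro {a = a} {b} p) {f} r z s = ≤-trans
      (forces-sound p (downward a (x∧y≤x _ _) r , downward b (x∧y≤y _ _) s))
      (≤-reflexive (P₁.⊥-homo f))
    -- Orthogonality applied to `y` itself gives `y ≤ y ∧ y ≤ ⊥`.
    forces-sound ¬-elim        (r , s) =
      ≤-trans (∧-greatest ≤-refl ≤-refl) (≤-trans (s _ r) ⊥-min)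
    forces-sound (¬¬-elim {a = a}) r = stable a r
    forces-sound (all-intro {a = a} p) r g = forces-sound p (Forces-cong a (≈.sym project₁) r)
    -- The quantifier is instantiated at the second coordinate of `f`; pairing it with the first
    -- gives `f` back.
    forces-sound (all-elim {b = b}) {f} r =
      Forces-cong b (unique ≈.refl ≈.refl) (r (π₂ ⊚ f))
    -- Both sides range over the same arrows `g`, and `(k ×id) ⊚ ⟨ f , g ⟩ ≈ ⟨ k ⊚ f , g ⟩`.
    forces-sound (all-[] {b = b} {f = k}) {f} r g = Forces-cong b (≈.sym (unique
      (≈.trans (≈.sym assoc) (≈.trans (⊚-cong project₁ ≈.refl)
        (≈.trans assoc (⊚-cong ≈.refl project₁))))
      (≈.trans (≈.sym assoc) (≈.trans (⊚-cong project₂ ≈.refl) project₂)))) (r g)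
    forces-sound (atom-mono p) {f} r = ≤-trans r (monotone (Functor.F₁ P f) p)
    forces-sound atom-∧ {f} (r , s) =
      ≤-trans (∧-greatest r s) (≤-reflexive (PA.sym (P₁.∧-homo f _ _)))
    -- Here `≤-refl` selects `P.reindex f p`, the largest element forcing `atom p`.
    forces-sound atom-¬ {f} r =
      ≤-trans (∧≤⊥⇒≤¬ (r _ ≤-refl)) (≤-reflexive (PA.sym (P₁.¬-homo f _)))
    forces-sound atom-[]       r = ≤-trans r (≤-reflexive (Functor.homo P _))
    forces-sound []-atom       r = ≤-trans r (≤-reflexive (PA.sym (Functor.homo P _)))
    forces-sound ([]-mono p)   r = forces-sound p r
    forces-sound ([]-cong {a = a} p) r = Forces-cong a (⊚-cong p ≈.refl) r
    forces-sound ([]-idm {a = a}) r = Forces-cong a identityˡ r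
    forces-sound (idm-[] {a = a}) r = Forces-cong a (≈.sym identityˡ) r
    forces-sound ([]-⊚ {a = a}) r = Forces-cong a assoc r
    forces-sound (⊚-[] {a = a}) r = Forces-cong a (≈.sym assoc) r
    forces-sound []-∧          r = r
    forces-sound []-¬          r = r

    -- Soundness is read at the identity of `X₀` and at the element `p`, where forcing an atom means
    -- lying below it.
    atom-reflects-≤ : ∀ {p q} → atom p ⊢ atom q → p ≤ q
    atom-reflects-≤ r = ≤-trans
      (forces-sound r (≤-reflexive (PA.sym (Functor.identity P _))))
      (≤-reflexive (Functor.identity P _))

  embed-injective : IsComponentwiseInjective C embed
  embed-injective X (p , q) = P≤.≤-antisym (atom-reflects-≤ p) (atom-reflects-≤ q)
    where open Forcing X

-- Product-preserving functors and pullback of first-order doctrines.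

module _ {C : FPCategory o₁ h₁ e₁} {D : FPCategory o h e} where
  private
    module C = FPCategory C
    module D = FPCategory D

  module Merge (M : FPFunctor C D) {X Y : C.Obj} where
    open FPFunctor M
    private
      module M× = IsProduct (preserves-× (C.isProduct {X} {Y}))
      open HomReasoning D.category

    joint-monic : ∀ {Z} {f g : Z D.⇒ F₀ (X C.× Y)} →
                  F₁ C.π₁ D.⊚ f D.≈ F₁ C.π₁ D.⊚ g →
                  F₁ C.π₂ D.⊚ f D.≈ F₁ C.π₂ D.⊚ g → f D.≈ g
    joint-monic p q = D.≈.trans (D.≈.sym (M×.unique p q)) (M×.unique D.≈.refl D.≈.refl)

    π₁-merge : F₁ C.π₁ D.⊚ merge X Y D.≈ D.π₁
    π₁-merge = M×.project₁

    π₂-merge : F₁ C.π₂ D.⊚ merge X Y D.≈ D.π₂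
    π₂-merge = M×.project₂

    -- Checked on the images of the two projections, which are jointly monic. It lets the adjunction
    -- in `pullback` undo reindexing along `merge`.
    merge-split : merge X Y D.⊚ D.⟨ F₁ C.π₁ , F₁ C.π₂ ⟩ D.≈ D.idm
    merge-split = joint-monic
      (begin
        F₁ C.π₁ D.⊚ merge X Y D.⊚ D.⟨ F₁ C.π₁ , F₁ C.π₂ ⟩    ≈⟨ D.assoc ⟨
        (F₁ C.π₁ D.⊚ merge X Y) D.⊚ D.⟨ F₁ C.π₁ , F₁ C.π₂ ⟩  ≈⟨ D.⊚-cong π₁-merge D.≈.refl ⟩
        D.π₁ D.⊚ D.⟨ F₁ C.π₁ , F₁ C.π₂ ⟩                     ≈⟨ D.project₁ ⟩
        F₁ C.π₁                                              ≈⟨ D.identityʳ ⟨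
        F₁ C.π₁ D.⊚ D.idm                                    ∎)
      (begin
        F₁ C.π₂ D.⊚ merge X Y D.⊚ D.⟨ F₁ C.π₁ , F₁ C.π₂ ⟩    ≈⟨ D.assoc ⟨
        (F₁ C.π₂ D.⊚ merge X Y) D.⊚ D.⟨ F₁ C.π₁ , F₁ C.π₂ ⟩  ≈⟨ D.⊚-cong π₂-merge D.≈.refl ⟩
        D.π₂ D.⊚ D.⟨ F₁ C.π₁ , F₁ C.π₂ ⟩                     ≈⟨ D.project₂ ⟩
        F₁ C.π₂                                              ≈⟨ D.identityʳ ⟨
        F₁ C.π₂ D.⊚ D.idm                                    ∎)

  merge-natural : (M : FPFunctor C D) → let open FPFunctor M in
                  ∀ {X X′ Y} (f : X′ C.⇒ X) →
                  merge X Y D.⊚ (F₁ f D.×id) D.≈ F₁ (f C.×id) D.⊚ merge X′ Y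
  merge-natural M {X} {X′} {Y} f = Merge.joint-monic M
    (begin
      F₁ C.π₁ D.⊚ merge X Y D.⊚ (F₁ f D.×id)      ≈⟨ D.assoc ⟨
      (F₁ C.π₁ D.⊚ merge X Y) D.⊚ (F₁ f D.×id)    ≈⟨ D.⊚-cong (Merge.π₁-merge M) D.≈.refl ⟩
      D.π₁ D.⊚ (F₁ f D.×id)                       ≈⟨ D.project₁ ⟩
      F₁ f D.⊚ D.π₁                               ≈⟨ D.⊚-cong D.≈.refl (Merge.π₁-merge M) ⟨
      F₁ f D.⊚ F₁ C.π₁ D.⊚ merge X′ Y             ≈⟨ D.assoc ⟨
      (F₁ f D.⊚ F₁ C.π₁) D.⊚ merge X′ Y           ≈⟨ D.⊚-cong homo D.≈.refl ⟨
      F₁ (f C.⊚ C.π₁) D.⊚ merge X′ Y              ≈⟨ D.⊚-cong (F₁-cong C.project₁) D.≈.refl ⟨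
      F₁ (C.π₁ C.⊚ (f C.×id)) D.⊚ merge X′ Y      ≈⟨ D.⊚-cong homo D.≈.refl ⟩
      (F₁ C.π₁ D.⊚ F₁ (f C.×id)) D.⊚ merge X′ Y   ≈⟨ D.assoc ⟩
      F₁ C.π₁ D.⊚ F₁ (f C.×id) D.⊚ merge X′ Y     ∎)
    (begin
      F₁ C.π₂ D.⊚ merge X Y D.⊚ (F₁ f D.×id)      ≈⟨ D.assoc ⟨
      (F₁ C.π₂ D.⊚ merge X Y) D.⊚ (F₁ f D.×id)    ≈⟨ D.⊚-cong (Merge.π₂-merge M) D.≈.refl ⟩
      D.π₂ D.⊚ (F₁ f D.×id)                       ≈⟨ D.project₂ ⟩
      D.π₂                                        ≈⟨ Merge.π₂-merge M ⟨
      F₁ C.π₂ D.⊚ merge X′ Y                      ≈⟨ D.⊚-cong (F₁-cong C.project₂) D.≈.refl ⟨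
      F₁ (C.π₂ C.⊚ (f C.×id)) D.⊚ merge X′ Y      ≈⟨ D.⊚-cong homo D.≈.refl ⟩
      (F₁ C.π₂ D.⊚ F₁ (f C.×id)) D.⊚ merge X′ Y   ≈⟨ D.assoc ⟩
      F₁ C.π₂ D.⊚ F₁ (f C.×id) D.⊚ merge X′ Y     ∎)
    where
    open FPFunctor M
    open HomReasoning D.category

  module _ (M N : FPFunctor C D) where
    private
      module M = FPFunctor M
      module N = FPFunctor N

    -- Naturality of `merge` in the functor. The map `c` acts first on the second factor and then on
    -- the first, since quantified object and parameter are changed by separate arguments in
    -- `castTransformation`.
    merge-transformation :
      (c : ∀ X → M.F₀ X D.⇒ N.F₀ X) →
      (∀ {X Y} (f : X C.⇒ Y) → c Y D.⊚ M.F₁ f D.≈ N.F₁ f D.⊚ c X) →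
      ∀ X Y → (N.merge X Y D.⊚ (c X D.×id)) D.⊚ D.⟨ D.π₁ , c Y D.⊚ D.π₂ ⟩ D.≈
              c (X C.× Y) D.⊚ M.merge X Y
    merge-transformation c c-natural X Y = Merge.joint-monic N
      (begin
        N.F₁ C.π₁ D.⊚ (N.merge X Y D.⊚ (c X D.×id)) D.⊚ i
          ≈⟨ components (Merge.π₁-merge N) ⟩
        D.π₁ D.⊚ (c X D.×id) D.⊚ i                 ≈⟨ D.assoc ⟨
        (D.π₁ D.⊚ (c X D.×id)) D.⊚ i               ≈⟨ D.⊚-cong D.project₁ D.≈.refl ⟩
        (c X D.⊚ D.π₁) D.⊚ i                       ≈⟨ D.assoc ⟩
        c X D.⊚ D.π₁ D.⊚ i                         ≈⟨ D.⊚-cong D.≈.refl D.project₁ ⟩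
        c X D.⊚ D.π₁                               ≈⟨ D.⊚-cong D.≈.refl (Merge.π₁-merge M) ⟨
        c X D.⊚ M.F₁ C.π₁ D.⊚ M.merge X Y          ≈⟨ natural C.π₁ ⟩
        N.F₁ C.π₁ D.⊚ c (X C.× Y) D.⊚ M.merge X Y  ∎)
      (begin
        N.F₁ C.π₂ D.⊚ (N.merge X Y D.⊚ (c X D.×id)) D.⊚ i
          ≈⟨ components (Merge.π₂-merge N) ⟩
        D.π₂ D.⊚ (c X D.×id) D.⊚ i                 ≈⟨ D.assoc ⟨
        (D.π₂ D.⊚ (c X D.×id)) D.⊚ i               ≈⟨ D.⊚-cong D.project₂ D.≈.refl ⟩
        D.π₂ D.⊚ i                                 ≈⟨ D.project₂ ⟩
        c Y D.⊚ D.π₂                               ≈⟨ D.⊚-cong D.≈.refl (Merge.π₂-merge M) ⟨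
        c Y D.⊚ M.F₁ C.π₂ D.⊚ M.merge X Y          ≈⟨ natural C.π₂ ⟩
        N.F₁ C.π₂ D.⊚ c (X C.× Y) D.⊚ M.merge X Y  ∎)
      where
      open HomReasoning D.category

      i : M.F₀ X D.× M.F₀ Y D.⇒ M.F₀ X D.× N.F₀ Y
      i = D.⟨ D.π₁ , c Y D.⊚ D.π₂ ⟩

      components : ∀ {A B E G H} {f : G D.⇒ H} {g : E D.⇒ G} {k : B D.⇒ E} {l : A D.⇒ B}
                   {m : E D.⇒ H} → f D.⊚ g D.≈ m → f D.⊚ (g D.⊚ k) D.⊚ l D.≈ m D.⊚ k D.⊚ l
      components p = D.≈.trans (D.⊚-cong D.≈.refl D.assoc)
        (D.≈.trans (D.≈.sym D.assoc) (D.⊚-cong p D.≈.refl))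

      natural : ∀ {A B Z} (f : A C.⇒ B) {k : Z D.⇒ M.F₀ A} →
                c B D.⊚ M.F₁ f D.⊚ k D.≈ N.F₁ f D.⊚ c A D.⊚ k
      natural f = D.≈.trans (D.≈.sym D.assoc)
        (D.≈.trans (D.⊚-cong (c-natural f) D.≈.refl) D.assoc)

  pullback : FPFunctor C D → FirstOrderDoctrine D ℓ → FirstOrderDoctrine C ℓ
  pullback M R = record
    { doctrine     = R.doctrine ∘F opF functor
    ; isFirstOrder = record
      { All            = λ Y X a → R.All (F₀ Y) (F₀ X) (R.reindex (merge X Y) a)
      ; All-monotone   = λ p → R.All-monotone (RP.reindex-mono _ p)
      ; All-adjoint    = λ {X} {Y} {a} {b} →
          (λ p → proj₁ R.All-adjoint (R≤.≤-trans
            (R≤.≤-reflexive (RA.sym (RP.reindex-triangle (Merge.π₁-merge M) a)))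
            (RP.reindex-mono (merge X Y) p))) ,
          -- The adjunction of `R` gives an inequality over `F₀ X D.× F₀ Y`; reindexing along the
          -- canonical map carries it to `F₀ (X C.× Y)`, where `merge-split` cancels `merge`.
          (λ p → R≤.≤-trans
            (R≤.≤-reflexive (RA.sym (RP.reindex-triangle D.project₁ a)))
            (R≤.≤-trans
              (RP.reindex-mono D.⟨ F₁ C.π₁ , F₁ C.π₂ ⟩ (proj₂ R.All-adjoint p))
              (R≤.≤-reflexive (RA.trans
                (RP.reindex-triangle (Merge.merge-split M) b)
                (Functor.identity R.doctrine b)))))
      ; beck-chevalley = λ f a → RA.trans (R.beck-chevalley (F₁ f) _)
          (RP.All-cong (RP.reindex-square (merge-natural M f) a))
      }
    }
    where
    open FPFunctor M
    module R = FirstOrderDoctrine R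
    module RA {X} = BooleanAlgebra (R.F₀ X)
    module R≤ {X} = BooleanOrder (R.F₀ X)
    module RP = FirstOrderProperties R

-- First-order morphisms as transformations over a fixed base.

module _ {C : FPCategory ℓ ℓ ℓ} {D : FPCategory o h e}
         (Q : FirstOrderDoctrine C ℓ) (R : FirstOrderDoctrine D ℓ) where
  private
    module C = FPCategory C
    module D = FPCategory D
    module Q = FirstOrderDoctrine Q
    module R = FirstOrderDoctrine R
    module RA {X} = BooleanAlgebra (R.F₀ X)
    module RP = FirstOrderProperties R

  -- The quantifier of `pullback M R` is the right-hand side of `IsFirstOrderMorphism`, so the two
  -- preservation conditions coincide by definition.
  fromTransformation : (M : FPFunctor C D) →
                       FirstOrderTransformation C Q (pullback M R) → FirstOrderMorphism C D Q R
  fromTransformation M T = record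
    { morphism             = record { base = M ; fibre = T.transformation }
    ; isFirstOrderMorphism = T.preserves-All
    }
    where module T = FirstOrderTransformation T

  module _ (M : FPFunctor C D) (N : FirstOrderMorphism C D Q R) where
    private
      module M = FPFunctor M
      module N = DoctrineMorphism (FirstOrderMorphism.morphism N)

    -- Conjugation by the casts along eq₀ moves N over the base M, where uniqueness is that
    -- of the adjunction over C.
    castTransformation :
      (eq₀ : ∀ X → M.F₀ X ≡ N.F₀ X) →
      (∀ {X Y} (f : X C.⇒ Y) → subst₂ D._⇒_ (eq₀ X) (eq₀ Y) (M.F₁ f) D.≈ N.F₁ f) →
      FirstOrderTransformation C Q (pullback M R)
    castTransformation eq₀ eq₁ = record
      { transformation = record
        { at      = λ X → Functor.F₁ R.doctrine (c X) ⊚ NatTrans.at N.fibre X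
        ; natural = λ f a → RA.trans
            (RP.reindex-cong (c _) (NatTrans.natural N.fibre f a))
            (RP.reindex-square (D.≈.sym (c-natural f)) _)
        }
      ; preserves-All = preserves-All
      }
      where
      open Category (BA ℓ) using (_⊚_)

      c : ∀ X → M.F₀ X D.⇒ N.F₀ X
      c X = RP.cast (eq₀ X)

      c-natural : ∀ {X Y} (f : X C.⇒ Y) → c Y D.⊚ M.F₁ f D.≈ N.F₁ f D.⊚ c X
      c-natural f = RP.cast-natural (eq₀ _) (eq₀ _) (eq₁ f)

      -- Beck-Chevalley replaces the parameter `N.F₀ X` by `M.F₀ X`, `All-cast` replaces the
      -- quantified `N.F₀ Y` by `M.F₀ Y`, and `merge-transformation` collects both casts into one on
      -- the product.
      preserves-All : ∀ X Y (a : Q.∣ X C.× Y ∣) →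
        R.Eq (M.F₀ X) (R.reindex (c X) (N.apply X (Q.All Y X a)))
          (R.All (M.F₀ Y) (M.F₀ X)
            (R.reindex (M.merge X Y) (R.reindex (c (X C.× Y)) (N.apply (X C.× Y) a))))
      preserves-All X Y a = begin
        R.reindex (c X) (N.apply X (Q.All Y X a))
          ≈⟨ RP.reindex-cong (c X) (FirstOrderMorphism.isFirstOrderMorphism N X Y a) ⟩
        R.reindex (c X) (R.All (N.F₀ Y) (N.F₀ X) (R.reindex (N.merge X Y) (N.apply _ a)))
          ≈⟨ R.beck-chevalley (c X) _ ⟩
        R.All (N.F₀ Y) (M.F₀ X)
          (R.reindex (c X D.×id) (R.reindex (N.merge X Y) (N.apply _ a)))
          ≈⟨ RP.All-cast (eq₀ Y) _ ⟩
        R.All (M.F₀ Y) (M.F₀ X) (R.reindex D.⟨ D.π₁ , c Y D.⊚ D.π₂ ⟩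
          (R.reindex (c X D.×id) (R.reindex (N.merge X Y) (N.apply _ a))))
          ≈⟨ RP.All-cong (RA.trans
               (RP.reindex-cong _ (RP.reindex-triangle D.≈.refl _))
               (RP.reindex-square
                 (merge-transformation M N.base c c-natural X Y) _)) ⟩
        R.All (M.F₀ Y) (M.F₀ X)
          (R.reindex (M.merge X Y) (R.reindex (c (X C.× Y)) (N.apply _ a)))
          ∎
        where open SetoidReasoning (BooleanAlgebra.setoid (R.F₀ (M.F₀ X)))

-- The unit as a quantifier completion.

module _ {C : FPCategory ℓ ℓ ℓ} (A : LeftAdjoint (Forgetful C)) (P : BooleanDoctrine C ℓ) where
  private
    FP = Functor.F₀ (LeftAdjoint.F A) P
    η = NatTrans.at (LeftAdjoint.unit A) P
    open AdjointTranspose (Forgetful C) A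

  module _ (G : FirstOrderDoctrine C ℓ) (m : NatTrans P (FirstOrderDoctrine.doctrine G)) where
    private
      module G = FirstOrderDoctrine G
      module T = FirstOrderTransformation (transpose {P} {G} m)

    -- `m` factors through the unit by its transpose. Taking the embedding into formulas for `m`
    -- settles injectivity for every left adjoint.
    unit-injective : IsComponentwiseInjective C {P} {G.doctrine} m →
                     IsComponentwiseInjective C {P} {FirstOrderDoctrine.doctrine FP} η
    unit-injective m-injective X {a} {b} p = m-injective X (begin
      BooleanHom.⟦_⟧ (NatTrans.at m X) a              ≈⟨ transpose-unit {P} {G} m X a ⟨
      T.apply X (BooleanHom.⟦_⟧ (NatTrans.at η X) a)  ≈⟨ BooleanHom.⟦⟧-cong (T.at X) p ⟩
      T.apply X (BooleanHom.⟦_⟧ (NatTrans.at η X) b)  ≈⟨ transpose-unit {P} {G} m X b ⟩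
      BooleanHom.⟦_⟧ (NatTrans.at m X) b              ∎)
      where open SetoidReasoning (BooleanAlgebra.setoid (G.F₀ X))

  unit-isQuantifierCompletion : ∀ o h e →
    IsQuantifierCompletion o h e P FP (overIdentity C {P} {FirstOrderDoctrine.doctrine FP} η)
  unit-isQuantifierCompletion o h e D R M =
    fromTransformation FP R M.base T ,
    record { eq₀ = λ X → ≡.refl
           ; eq₁ = λ f → D.≈.refl
           ; eqᶠ = λ X a → RA.sym (transpose-unit m X a) } ,
    -- The unit lies over the identity, so `E` already compares the bases of `M` and `N`, and `eq₀`
    -- and `eq₁` are reused. For the fibres, `T` and the conjugate `S` of `N` agree after the unit,
    -- hence everywhere.
    λ N E → let open _≐_ E
                S = castTransformation FP R M.base N eq₀ eq₁
            in record
      { eq₀ = eq₀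
      ; eq₁ = eq₁
      ; eqᶠ = λ X a → RP.reindex-cast (eq₀ X) (unit-determines T S
          (λ Y b → RA.trans (transpose-unit m Y b) (RP.reindex-cast⁻ (eq₀ Y) (eqᶠ Y b))) X a)
      }
    where
    module D = FPCategory D
    module M = DoctrineMorphism M
    module RA {X} = BooleanAlgebra (FirstOrderDoctrine.F₀ R X)
    module RP = FirstOrderProperties R

    m : NatTrans P (FirstOrderDoctrine.doctrine (pullback M.base R))
    m = M.fibre

    T : FirstOrderTransformation C FP (pullback M.base R)
    T = transpose m

forgetful-leftAdjoint : (C : FPCategory ℓ ℓ ℓ) → LeftAdjoint (Forgetful C)
forgetful-leftAdjoint C = leftAdjoint-from-universal-arrows (Forgetful C)
  Free.free Free.embed (λ {P} {G} m → Free.Extend.extend P G m)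
  (λ {P} {G} m X p → BooleanAlgebra.refl (FirstOrderDoctrine.F₀ G X))
  (λ {P} {G} S T p → Free.atoms-determine P G S T p)

theorem5p4 :
    {ℓ : Level} (o h e : Level) (C : FPCategory ℓ ℓ ℓ) →
    LeftAdjoint (Forgetful C)
    and ((A : LeftAdjoint (Forgetful C)) (P : BooleanDoctrine C ℓ) →
         let F = Functor.F₀ (LeftAdjoint.F A)
             η = NatTrans.at (LeftAdjoint.unit A) in
         IsComponentwiseInjective C (η P)
         and IsQuantifierCompletion o h e P (F P) (overIdentity C (η P)))
theorem5p4 o h e C = forgetful-leftAdjoint C , λ A P →
  unit-injective A P (Free.free P) (Free.embed P) (Free.embed-injective P) ,
  unit-isQuantifierCompletion A P o h e
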